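{- Let $n$ be a positive integer and $k$ an integer with $n/3 + \sqrt{2n \ln 2} \le k \le n/2$. If $M_{k-1} \le m \le M_k$, then every family $\mathcal{F}$ of $m$ subsets of $[n]$ which maximises the number of comparable pairs among all families of $m$ subsets of $[n]$ satisfies $\mathcal{H}_{k-1} \subseteq \mathcal{F} \subseteq \mathcal{H}_k$.
   Context: For $0 \le j \le n/2$, $\mathcal{H}_j = \{F \subseteq [n]: |F| \le j\} \cup \{F \subseteq [n] : |F| \ge n-j\}$ and $M_j = |\mathcal{H}_j| = 2\sum_{i \le j}\binom{n}{i}$. A comparable pair in $\mathcal{F}$ is an unordered pair of distinct sets $A,B\in\mathcal{F}$ with $A\subseteq B$ or $B \subseteq A$. $\ln$ is the natural logarithm. -}

module Defs where

open import Data.Bool using (Bool; _∨_)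
open import Data.Nat using (ℕ; zero; suc; _+_; _*_; _∸_; _^_; _≤_)
open import Data.Nat.Properties using (m*n≢0; m^n≢0)
open import Data.Nat.Combinatorics using (_C_)
open import Data.Integer using (+_)
open import Data.Rational.Unnormalised using (ℚᵘ; 0ℚᵘ; _/_) renaming (_+_ to _+ᵘ_)
open import Data.List using (List; []; _∷_; length; filter)
open import Data.List.Relation.Unary.Unique.Propositional using (Unique)
open import Data.Fin.Subset using (Subset; _⊆_; ∣_∣)
open import Data.Fin.Subset.Properties using (_⊆?_)
open import Data.Product using (_×_)
open import Data.Sum using (_⊎_)
open import Relation.Nullary.Decidable using (Dec; _⊎-dec_)
open import Relation.Binary.PropositionalEquality using (_≡_)

comparable? : ∀ {n} (A B : Subset n) → Dec ((A ⊆ B) ⊎ (B ⊆ A))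
comparable? A B = (A ⊆? B) ⊎-dec (B ⊆? A)

compPairs : ∀ {n} → List (Subset n) → ℕ
compPairs []       = 0
compPairs (A ∷ As) = length (filter (comparable? A) As) + compPairs As

IsFamily : (n m : ℕ) → List (Subset n) → Set
IsFamily n m F = Unique F × length F ≡ m

IsMaximiser : (n m : ℕ) → List (Subset n) → Set
IsMaximiser n m F = IsFamily n m F × (∀ G → IsFamily n m G → compPairs G ≤ compPairs F)

InH : ∀ {n} → ℕ → Subset n → Set
InH {n} j A = ∣ A ∣ ≤ j ⊎ n ∸ j ≤ ∣ A ∣

sumBinom : ℕ → ℕ → ℕ
sumBinom n zero    = n C 0
sumBinom n (suc j) = sumBinom n j + n C suc j

M : ℕ → ℕ → ℕ
M n j = 2 * sumBinom n j

-- Partial sums of ln 2 = Σ_{i ≥ 1} 1 / (i 2^i):  lnTwoPartial N = Σ_{i=1}^{N} 1/(i 2^i)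
lnTwoPartial : ℕ → ℚᵘ
lnTwoPartial zero    = 0ℚᵘ
lnTwoPartial (suc N) =
  lnTwoPartial N +ᵘ (_/_ (+ 1) (suc N * 2 ^ suc N) {{m*n≢0 (suc N) (2 ^ suc N) {{_}} {{m^n≢0 2 (suc N)}}}})

{-# OPTIONS --safe #-}
module Submission where

-- Let H be the family of sets counted by M n (k - 1), let S be the members of H missing from F, and
-- let T consist of |S| members of F outside H.  A member of T is comparable to at most
-- D = 2 ^ k + 2 ^ (n - k) sets, and replacing T by S must not create more comparable pairs.  The
-- hypothesis gives 12 n ≤ (3 k - n)², because 1/2 + 1/8 + 1/24 = 2/3 ≤ ln 2, and Chebyshev's inequality
-- then shows that at most 1/8 of the subsets of an (n - k + 1)-set have more than k - 5 elements.
-- So a set in H is comparable to more than 12 D / 11 sets in the outer layers InH (k - 5), and a set in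
-- InH (k - 5) to more than 12 D sets of H.  Splitting each pair inside S unequally between its two
-- ends, with the larger share going to the end in InH (k - 5), shows that the exchange gains unless
-- S is empty.  Once H ⊆ F, exchanging a single set gives F ⊆ H_k.

open import Defs
open import Data.Nat hiding (_/_)
open import Data.Nat.Properties
open import Data.Nat.Combinatorics using (_C_; nCk+nC[k+1]≡[n+1]C[k+1])
open import Data.Nat.ListAction using (sum)
open import Data.Nat.ListAction.Properties using (sum-++; sum-↭)
open import Data.Nat.Tactic.RingSolver using (solve-∀)
import Data.Bool.Properties as Bool
import Data.Integer as ℤ
import Data.Integer.Properties as ℤ
open import Data.Rational.Unnormalised using (_/_) renaming (_≤_ to _≤ᵘ_; _*_ to _*ᵘ_)
open import Data.Rational.Unnormalised.Properties using (drop-*≤*)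
open import Data.Fin.Subset using (Subset; inside; outside; _⊆_; ∣_∣; ∁; ⊤; ⊥)
open import Data.Fin.Subset.Properties
  using ( _⊆?_; out⊆; in⊆in; drop-∷-⊆; ⊆-refl; ⊆-antisym; ⊆-max; ⊆-min; p⊆q⇒∁p⊇∁q
        ; x∈∁p⇒x∉p; x∉∁p⇒x∈p; x∉p⇒x∈∁p; x∈p⇒x∉∁p; ∣p∣≤n; ∣∁p∣≡n∸∣p∣; ∣⊤∣≡n; ∣⊥∣≡0)
open import Data.List using (List; []; _∷_; [_]; _++_; map; length; filter; take; drop)
open import Data.List.Properties
  using (length-map; length-++; map-++; filter-++; filter-accept; partition-defn; length-take; take++drop≡id)
open import Data.List.Membership.Propositional using (_∈_; _∉_)
open import Data.List.Membership.Propositional.Properties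
  using (∈-map⁺; ∈-map⁻; ∈-++⁺ˡ; ∈-++⁺ʳ; ∈-++⁻; ∈-filter⁺; ∈-filter⁻; ∈-∃++)
import Data.List.Membership.DecPropositional as DecMembership
open import Data.List.Relation.Unary.All using ([]; _∷_)
open import Data.List.Relation.Unary.All.Properties using (¬Any⇒All¬)
open import Data.List.Relation.Unary.AllPairs using ([]; _∷_)
open import Data.List.Relation.Unary.Any using (here; there)
open import Data.List.Relation.Unary.Unique.Propositional using (Unique)
open import Data.List.Relation.Unary.Unique.Propositional.Properties as Unique using (Unique[x∷xs]⇒x∉xs)
open import Data.List.Relation.Binary.Permutation.Propositional
  using (_↭_; ↭-trans; ↭-sym; ↭-reflexive; ↭⇒↭ₛ; ↭ₛ⇒↭)
import Data.List.Relation.Binary.Permutation.Propositional.Properties as ↭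
import Data.List.Relation.Binary.Permutation.Setoid.Properties as ↭ₛ
open import Data.Vec using ([]; _∷_; here)
import Data.Vec.Properties as Vec
open import Data.Product using (_,_; ∃; _×_; proj₁; proj₂)
open import Data.Sum using (_⊎_; inj₁; inj₂; [_,_]′)
open import Function using (_∘_; id)
open import Relation.Nullary using (¬_; Dec; yes; no; contradiction)
open import Relation.Nullary.Decidable using (_⊎-dec_; decidable-stable)
open import Relation.Unary using (Pred; Decidable)
open import Relation.Unary.Properties using (∁?)
open import Relation.Binary.PropositionalEquality hiding ([_])

-- Partial sums of binomial coefficients.

sumBinom-zeroˡ : ∀ j → sumBinom 0 j ≡ 1
sumBinom-zeroˡ zero    = refl
sumBinom-zeroˡ (suc j) = trans (+-identityʳ _) (sumBinom-zeroˡ j)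

sumBinom-pascal : ∀ n j → sumBinom (suc n) (suc j) ≡ sumBinom n (suc j) + sumBinom n j
sumBinom-pascal n zero = begin
  1 + suc n C 1           ≡⟨ cong (1 +_) (sym (nCk+nC[k+1]≡[n+1]C[k+1] n 0)) ⟩
  1 + (n C 0 + n C 1)     ≡⟨ +-comm 1 _ ⟩
  (1 + n C 1) + 1         ∎
  where open ≡-Reasoning
sumBinom-pascal n (suc j) = begin
  sumBinom (suc n) (suc j) + suc n C suc (suc j)
    ≡⟨ cong₂ _+_ (sumBinom-pascal n j) (sym (nCk+nC[k+1]≡[n+1]C[k+1] n (suc j))) ⟩
  (sumBinom n (suc j) + sumBinom n j) + (n C suc j + n C suc (suc j))
    ≡⟨ rearrange (sumBinom n (suc j)) (sumBinom n j) (n C suc j) (n C suc (suc j)) ⟩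
  (sumBinom n (suc j) + n C suc (suc j)) + (sumBinom n j + n C suc j) ∎
  where
  open ≡-Reasoning
  rearrange : ∀ a b c d → (a + b) + (c + d) ≡ (a + d) + (b + c)
  rearrange = solve-∀

sumBinom-monoʳ : ∀ n {i j} → i ≤ j → sumBinom n i ≤ sumBinom n j
sumBinom-monoʳ n i≤j = go (≤⇒≤′ i≤j)
  where
  go : ∀ {i j} → i ≤′ j → sumBinom n i ≤ sumBinom n j
  go ≤′-refl         = ≤-refl
  go (≤′-step i≤′j)  = ≤-trans (go i≤′j) (m≤m+n _ _)

sumBinom-suc-≥ : ∀ n j → sumBinom n j ≤ sumBinom (suc n) j
sumBinom-suc-≥ n zero    = ≤-refl
sumBinom-suc-≥ n (suc j) = ≤-trans (m≤m+n _ _) (≤-reflexive (sym (sumBinom-pascal n j)))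

sumBinom-monoˡ : ∀ {m n} j → m ≤ n → sumBinom m j ≤ sumBinom n j
sumBinom-monoˡ j m≤n = go (≤⇒≤′ m≤n)
  where
  go : ∀ {m n} → m ≤′ n → sumBinom m j ≤ sumBinom n j
  go ≤′-refl         = ≤-refl
  go (≤′-step m≤′n)  = ≤-trans (go m≤′n) (sumBinom-suc-≥ _ j)

sumBinom-suc-≤ : ∀ n j → sumBinom (suc n) j ≤ 2 * sumBinom n j
sumBinom-suc-≤ n zero    = m≤m+n 1 1
sumBinom-suc-≤ n (suc j) = begin
  sumBinom (suc n) (suc j)            ≡⟨ sumBinom-pascal n j ⟩
  sumBinom n (suc j) + sumBinom n j   ≤⟨ +-monoʳ-≤ (sumBinom n (suc j)) (sumBinom-monoʳ n (n≤1+n j)) ⟩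
  sumBinom n (suc j) + sumBinom n (suc j) ≡⟨ cong (sumBinom n (suc j) +_) (sym (+-identityʳ _)) ⟩
  2 * sumBinom n (suc j) ∎
  where open ≤-Reasoning

sumBinom-suc-suc-≥ : ∀ n j → 2 * sumBinom n j ≤ sumBinom (suc n) (suc j)
sumBinom-suc-suc-≥ n j = begin
  2 * sumBinom n j                    ≡⟨ cong (sumBinom n j +_) (+-identityʳ _) ⟩
  sumBinom n j + sumBinom n j         ≤⟨ +-monoˡ-≤ (sumBinom n j) (sumBinom-monoʳ n (n≤1+n j)) ⟩
  sumBinom n (suc j) + sumBinom n j   ≡⟨ sumBinom-pascal n j ⟨
  sumBinom (suc n) (suc j)            ∎
  where open ≤-Reasoning

-- Any subset of `i` extra points can be added to a set of at most `j` points, and the results are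
-- distinct sets of at most `i + j` points. The case `i = 4` provides the large factor in
-- `outer-bound`.
sumBinom-+-+-≥ : ∀ i n j → 2 ^ i * sumBinom n j ≤ sumBinom (i + n) (i + j)
sumBinom-+-+-≥ zero    n j = ≤-reflexive (*-identityˡ _)
sumBinom-+-+-≥ (suc i) n j = begin
  2 * 2 ^ i * sumBinom n j         ≡⟨ *-assoc 2 (2 ^ i) _ ⟩
  2 * (2 ^ i * sumBinom n j)       ≤⟨ *-monoʳ-≤ 2 (sumBinom-+-+-≥ i n j) ⟩
  2 * sumBinom (i + n) (i + j)     ≤⟨ sumBinom-suc-suc-≥ (i + n) (i + j) ⟩
  sumBinom (suc i + n) (suc i + j) ∎
  where open ≤-Reasoning

sumBinom-full : ∀ n {j} → n ≤ j → sumBinom n j ≡ 2 ^ n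
sumBinom-full zero    {j}     _         = sumBinom-zeroˡ j
sumBinom-full (suc n) {suc j} (s≤s n≤j) = begin
  sumBinom (suc n) (suc j)            ≡⟨ sumBinom-pascal n j ⟩
  sumBinom n (suc j) + sumBinom n j   ≡⟨ cong₂ _+_ (sumBinom-full n (m≤n⇒m≤1+n n≤j)) (sumBinom-full n n≤j) ⟩
  2 ^ n + 2 ^ n                       ≡⟨ cong (2 ^ n +_) (sym (+-identityʳ _)) ⟩
  2 * 2 ^ n                           ∎
  where open ≡-Reasoning

-- One more point doubles `2 ^ n` but at most doubles the number of sets of size at most `j`, so the
-- fraction of such sets can only fall as `n` grows. A bound for the largest ground set thus passes
-- to all smaller ones.
sumBinom-fraction-anti : ∀ {a b m n} j → m ≤ n → a * 2 ^ n ≤ b * sumBinom n j → a * 2 ^ m ≤ b * sumBinom m j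
sumBinom-fraction-anti {a} {b} j m≤n = go (≤⇒≤′ m≤n)
  where
  open ≤-Reasoning
  swap : ∀ x y → x * (2 * y) ≡ 2 * (x * y)
  swap = solve-∀
  go : ∀ {m n} → m ≤′ n → a * 2 ^ n ≤ b * sumBinom n j → a * 2 ^ m ≤ b * sumBinom m j
  go ≤′-refl le = le
  go {n = suc n} (≤′-step m≤′n) le = go m≤′n (*-cancelˡ-≤ 2 (begin
    2 * (a * 2 ^ n)         ≡⟨ swap a (2 ^ n) ⟨
    a * 2 ^ suc n           ≤⟨ le ⟩
    b * sumBinom (suc n) j  ≤⟨ *-monoʳ-≤ b (sumBinom-suc-≤ n j) ⟩
    b * (2 * sumBinom n j)  ≡⟨ swap b (sumBinom n j) ⟩
    2 * (b * sumBinom n j)  ∎))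

-- By Pascal's rule the increment of `sumBinom a (suc j)` in `a` is `sumBinom a j`, which grows with
-- `a`.
sumBinom-convex : ∀ {a b} j → a ≤ b →
  sumBinom (suc a) j + sumBinom b j ≤ sumBinom a j + sumBinom (suc b) j
sumBinom-convex zero    _   = ≤-refl
sumBinom-convex {a} {b} (suc j) a≤b = begin
  sumBinom (suc a) (suc j) + sumBinom b (suc j)
    ≡⟨ cong (_+ sumBinom b (suc j)) (sumBinom-pascal a j) ⟩
  sumBinom a (suc j) + sumBinom a j + sumBinom b (suc j)
    ≤⟨ +-monoˡ-≤ (sumBinom b (suc j)) (+-monoʳ-≤ (sumBinom a (suc j)) (sumBinom-monoˡ j a≤b)) ⟩
  sumBinom a (suc j) + sumBinom b j + sumBinom b (suc j)
    ≡⟨ rearrange (sumBinom a (suc j)) (sumBinom b j) (sumBinom b (suc j)) ⟩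
  sumBinom a (suc j) + (sumBinom b (suc j) + sumBinom b j)
    ≡⟨ cong (sumBinom a (suc j) +_) (sumBinom-pascal b j) ⟨
  sumBinom a (suc j) + sumBinom (suc b) (suc j) ∎
  where
  open ≤-Reasoning
  rearrange : ∀ x y z → x + y + z ≡ x + (z + y)
  rearrange = solve-∀

-- This takes `d` convexity steps, each moving one unit from the smaller argument to the larger.
sumBinom-spread : ∀ j a b d → b + d ≤ a →
  sumBinom (b + d) j + sumBinom a j ≤ sumBinom b j + sumBinom (a + d) j
sumBinom-spread j a b zero    _ = ≤-reflexive (cong₂ (λ x y → sumBinom x j + sumBinom y j) (+-identityʳ b) (sym (+-identityʳ a)))
sumBinom-spread j a b (suc d) le rewrite +-suc b d | +-suc a d =
  ≤-trans (sumBinom-convex j (<⇒≤ le)) (sumBinom-spread j (suc a) b d (m≤n⇒m≤1+n (<⇒≤ le)))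

-- For |B| = b this counts the sets X ⊆ B with |X| ≤ j together with the sets X ⊇ B with |X| ≥ n - j.
nested : ℕ → ℕ → ℕ → ℕ
nested n j b = sumBinom b j + sumBinom (n ∸ b) j

nested-sym : ∀ {n b} j → b ≤ n → nested n j (n ∸ b) ≡ nested n j b
nested-sym {n} {b} j b≤n = trans (+-comm (sumBinom (n ∸ b) j) _) (cong (λ x → sumBinom x j + sumBinom (n ∸ b) j) (m∸[m∸n]≡n b≤n))

-- The arguments `c` and `n ∸ c` have a fixed sum; replacing them by `b` and `n ∸ b` moves them
-- apart, so convexity raises the total.
nested-anti : ∀ {n b c} j → b ≤ c → c + c ≤ n → nested n j c ≤ nested n j b
nested-anti {n} {b} {c} j b≤c 2c≤n =
  subst₂ (λ x y → sumBinom x j + sumBinom (n ∸ c) j ≤ sumBinom b j + sumBinom y j)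
    b+d≡c a+d≡n∸b
    (sumBinom-spread j (n ∸ c) b (c ∸ b) (≤-trans (≤-reflexive b+d≡c) (m+n≤o⇒m≤o∸n c 2c≤n)))
  where
  b+d≡c : b + (c ∸ b) ≡ c
  b+d≡c = m+[n∸m]≡n b≤c
  a+d≡n∸b : n ∸ c + (c ∸ b) ≡ n ∸ b
  a+d≡n∸b = trans (sym (+-∸-assoc (n ∸ c) b≤c)) (cong (_∸ b) (m∸n+n≡m (m+n≤o⇒m≤o c 2c≤n)))

-- Chebyshev's inequality for binomial tails.

2mn≤m²+n² : ∀ m n → 2 * m * n ≤ m * m + n * n
2mn≤m²+n² m n with ≤-total m n
... | inj₁ m≤n =
  subst (λ y → 2 * m * y ≤ m * m + y * y) (m+[n∸m]≡n m≤n)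
    (≤-trans (m≤m+n _ _) (≤-reflexive (expand m (n ∸ m))))
  where
  expand : ∀ x e → 2 * x * (x + e) + e * e ≡ x * x + (x + e) * (x + e)
  expand = solve-∀
... | inj₂ n≤m =
  subst (λ x → 2 * x * n ≤ x * x + n * n) (m+[n∸m]≡n n≤m)
    (≤-trans (m≤m+n _ _) (≤-reflexive (expand n (m ∸ n))))
  where
  expand : ∀ y e → 2 * (y + e) * y + e * e ≡ (y + e) * (y + e) + y * y
  expand = solve-∀

-- Chebyshev's inequality for n fair coin tosses.  With z = d + n - 2 (j + 1) it says
-- d² (2 ^ n - sumBinom n j) ≤ 2 ^ n (n + z²), the second moment of a ±1 walk started at z, which
-- ends at or above d exactly when more than j tosses are heads; z² is expanded and the subtractions moved.
chebyshev : ∀ n j d →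
  d * d * 2 ^ n + 2 ^ n * (4 * suc j * (d + n))
    ≤ d * d * sumBinom n j + 2 ^ n * (n + (d + n) * (d + n) + 4 * suc j * suc j)
-- Without tosses the inequality says `z² ≥ 0` for `z = d - 2 (j + 1)`.
chebyshev zero j d = begin
  d * d * 1 + 1 * (4 * suc j * (d + 0))        ≡⟨ lhs (suc j) d ⟩
  d * d * 1 + 2 * d * (2 * suc j)              ≤⟨ +-monoʳ-≤ (d * d * 1) (2mn≤m²+n² d (2 * suc j)) ⟩
  d * d * 1 + (d * d + 2 * suc j * (2 * suc j)) ≡⟨ rhs (suc j) d ⟩
  d * d * 1 + 1 * (0 + (d + 0) * (d + 0) + 4 * suc j * suc j)
    ≡⟨ cong (λ x → d * d * x + 1 * (0 + (d + 0) * (d + 0) + 4 * suc j * suc j)) (sumBinom-zeroˡ j) ⟨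
  d * d * sumBinom 0 j + 1 * (0 + (d + 0) * (d + 0) + 4 * suc j * suc j) ∎
  where
  open ≤-Reasoning
  lhs : ∀ s d → d * d * 1 + 1 * (4 * s * (d + 0)) ≡ d * d * 1 + 2 * d * (2 * s)
  lhs = solve-∀
  rhs : ∀ s d → d * d * 1 + (d * d + 2 * s * (2 * s)) ≡ d * d * 1 + 1 * (0 + (d + 0) * (d + 0) + 4 * s * s)
  rhs = solve-∀
-- After a first head there are certainly more than `j = 0` heads, so that half only needs
-- `d² ≤ n + (d + n)²`; after a first tail the induction hypothesis applies.
chebyshev (suc n) zero d =
  subst₂ _≤_ (lhs d n (2 ^ n)) (rhs d n (2 ^ n))
    (+-monoˡ-≤ (4 * 2 ^ n * (d + n) + 8 * 2 ^ n) (+-mono-≤ (chebyshev n zero d) trivial))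
  where
  trivial : d * d * 2 ^ n ≤ 2 ^ n * (n + (d + n) * (d + n))
  trivial = ≤-trans (≤-reflexive (*-comm (d * d) (2 ^ n)))
    (*-monoʳ-≤ (2 ^ n) (≤-trans (*-mono-≤ (m≤m+n d n) (m≤m+n d n)) (m≤n+m _ n)))
  lhs : ∀ d n p → d * d * p + p * (4 * 1 * (d + n)) + d * d * p + (4 * p * (d + n) + 8 * p)
      ≡ d * d * (2 * p) + 2 * p * (4 * 1 * (d + (1 + n)))
  lhs = solve-∀
  rhs : ∀ d n p → d * d * 1 + p * (n + (d + n) * (d + n) + 4 * 1 * 1) + p * (n + (d + n) * (d + n)) + (4 * p * (d + n) + 8 * p)
      ≡ d * d * 1 + 2 * p * (1 + n + (d + (1 + n)) * (d + (1 + n)) + 4 * 1 * 1)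
  rhs = solve-∀
-- The first toss leads to walks started at `z - 1` and `z + 1`, and
-- `(z - 1)² + (z + 1)² = 2 z² + 2` accounts for the extra toss in the variance. The summand added
-- to both sides makes up for the moved subtractions.
chebyshev (suc n) (suc j) d rewrite sumBinom-pascal n j =
  subst₂ _≤_ (lhs d n j (2 ^ n)) (rhs d n j (2 ^ n) (sumBinom n (suc j)) (sumBinom n j))
    (+-monoˡ-≤ (4 * 2 ^ n * (d + n) + 8 * 2 ^ n * (2 + j)) (+-mono-≤ (chebyshev n (suc j) d) (chebyshev n j d)))
  where
  lhs : ∀ d n j p → d * d * p + p * (4 * (2 + j) * (d + n)) + (d * d * p + p * (4 * (1 + j) * (d + n)))
        + (4 * p * (d + n) + 8 * p * (2 + j))
      ≡ d * d * (2 * p) + 2 * p * (4 * (2 + j) * (d + (1 + n)))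
  lhs = solve-∀
  rhs : ∀ d n j p u v → d * d * u + p * (n + (d + n) * (d + n) + 4 * (2 + j) * (2 + j))
        + (d * d * v + p * (n + (d + n) * (d + n) + 4 * (1 + j) * (1 + j))) + (4 * p * (d + n) + 8 * p * (2 + j))
      ≡ d * d * (u + v) + 2 * p * (1 + n + (d + (1 + n)) * (d + (1 + n)) + 4 * (2 + j) * (2 + j))
  rhs = solve-∀

-- The condition `d + n = 2 (j + 1)` is `z = 0` in `chebyshev`, which becomes
-- `d² (2 ^ n - sumBinom n j) ≤ 2 ^ n n`; then `8 n ≤ d²` bounds the missing fraction by 1/8.
seven-eighths : ∀ n j d .{{_ : NonZero d}} → d + n ≡ 2 * suc j → 8 * n ≤ d * d → 7 * 2 ^ n ≤ 8 * sumBinom n j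
seven-eighths n j d d+n≡2s 8n≤d² = *-cancelˡ-≤ (d * d) {{m*n≢0 d d}} (+-cancelʳ-≤ (d * d * 2 ^ n) _ _ (begin
  d * d * (7 * 2 ^ n) + d * d * 2 ^ n          ≡⟨ e₁ (d * d) (2 ^ n) ⟩
  8 * (d * d * 2 ^ n)                          ≤⟨ *-monoʳ-≤ 8 centred ⟩
  8 * (d * d * sumBinom n j + 2 ^ n * n)       ≡⟨ e₂ (d * d) (sumBinom n j) (2 ^ n) n ⟩
  d * d * (8 * sumBinom n j) + 2 ^ n * (8 * n) ≤⟨ +-monoʳ-≤ (d * d * (8 * sumBinom n j)) (*-monoʳ-≤ (2 ^ n) 8n≤d²) ⟩
  d * d * (8 * sumBinom n j) + 2 ^ n * (d * d) ≡⟨ cong (d * d * (8 * sumBinom n j) +_) (*-comm (2 ^ n) (d * d)) ⟩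
  d * d * (8 * sumBinom n j) + d * d * 2 ^ n   ∎))
  where
  open ≤-Reasoning
  e₁ : ∀ q p → q * (7 * p) + q * p ≡ 8 * (q * p)
  e₁ = solve-∀
  e₂ : ∀ q v p n → 8 * (q * v + p * n) ≡ q * (8 * v) + p * (8 * n)
  e₂ = solve-∀
  e₃ : ∀ x p s n → x + p * (n + 2 * s * (2 * s) + 4 * s * s) ≡ x + p * n + p * (4 * s * (2 * s))
  e₃ = solve-∀
  centred : d * d * 2 ^ n ≤ d * d * sumBinom n j + 2 ^ n * n
  centred = +-cancelʳ-≤ (2 ^ n * (4 * suc j * (2 * suc j))) _ _ (begin
    d * d * 2 ^ n + 2 ^ n * (4 * suc j * (2 * suc j))
      ≡⟨ cong (λ x → d * d * 2 ^ n + 2 ^ n * (4 * suc j * x)) d+n≡2s ⟨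
    d * d * 2 ^ n + 2 ^ n * (4 * suc j * (d + n))
      ≤⟨ chebyshev n j d ⟩
    d * d * sumBinom n j + 2 ^ n * (n + (d + n) * (d + n) + 4 * suc j * suc j)
      ≡⟨ cong (λ x → d * d * sumBinom n j + 2 ^ n * (n + x * x + 4 * suc j * suc j)) d+n≡2s ⟩
    d * d * sumBinom n j + 2 ^ n * (n + 2 * suc j * (2 * suc j) + 4 * suc j * suc j)
      ≡⟨ e₃ (d * d * sumBinom n j) (2 ^ n) (suc j) n ⟩
    d * d * sumBinom n j + 2 ^ n * n + 2 ^ n * (4 * suc j * (2 * suc j)) ∎)

-- Numerical consequences of the lower bound on k.

-- 18 n lnTwoPartial 3 = 12 n
twelve-n≤ : ∀ n s → (ℤ.+ (18 * n) / 1) *ᵘ lnTwoPartial 3 ≤ᵘ ℤ.+ s / 1 → 12 * n ≤ s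
twelve-n≤ n s le = *-cancelˡ-≤ 384 (subst₂ _≤_ (lhs n) (*-comm s 384) (ℤ.drop‿+≤+ ℕ-le))
  where
  lhs : ∀ n → 18 * n * 256 * 1 ≡ 384 * (12 * n)
  lhs = solve-∀
  -- Unnormalised addition leaves 1/2 + 1/8 + 1/24 in the form 256/384, and `18 * 256 = 12 * 384`.
  ℕ-le : ℤ.+ (18 * n * 256 * 1) ℤ.≤ ℤ.+ (s * 384)
  ℕ-le = subst₂ ℤ._≤_
    (trans (cong (ℤ._* ℤ.+ 1) (sym (ℤ.pos-* (18 * n) 256))) (sym (ℤ.pos-* (18 * n * 256) 1)))
    (sym (ℤ.pos-* s 384))
    (drop-*≤* le)

-- Here e = n - k and q = 3 k - n.
small-tail : ∀ {k e q} → 0 < k → k ≤ e → q + e ≡ 2 * k → 12 * (k + e) ≤ q ^ 2 →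
  24 ≤ k × 7 * 2 ^ suc e ≤ 8 * sumBinom (suc e) (k ∸ 5)
small-tail {k} {e} {q} 0<k k≤e q+e≡2k 12n≤q² = ≤-trans 24≤q q≤k ,
  -- For `suc e` tosses and `j = k - 5`, centring forces `d = 2 (k - 4) - (e + 1) = q - 9`.
  seven-eighths (suc e) (k ∸ 5) (q ∸ 9) {{>-nonZero (m<n⇒0<n∸m (≤-trans (m≤m+n 10 14) 24≤q))}} centre deviation
  where
  open ≤-Reasoning
  q≤k : q ≤ k
  q≤k = +-cancelʳ-≤ k q k (begin
    q + k   ≤⟨ +-monoʳ-≤ q k≤e ⟩
    q + e   ≡⟨ q+e≡2k ⟩
    2 * k   ≡⟨ cong (k +_) (+-identityʳ k) ⟩
    k + k   ∎)
  0<q : 0 < q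
  0<q = n≢0⇒n>0 λ q≡0 → <⇒≱ (≤-trans 0<k (m≤m+n k e))
    (*-cancelˡ-≤ {k + e} {0} 12 (subst (λ x → 12 * (k + e) ≤ x ^ 2) q≡0 12n≤q²))
  24≤q : 24 ≤ q
  -- Both `k` and `e` are at least `q`, so `24 q ≤ 12 (k + e) ≤ q²`.
  24≤q = *-cancelʳ-≤ 24 q q {{>-nonZero 0<q}} (begin
    24 * q         ≡⟨ split q ⟩
    12 * (q + q)   ≤⟨ *-monoʳ-≤ 12 (+-mono-≤ q≤k (≤-trans q≤k k≤e)) ⟩
    12 * (k + e)   ≤⟨ 12n≤q² ⟩
    q ^ 2          ≡⟨ cong (q *_) (*-identityʳ q) ⟩
    q * q          ∎)
    where
    split : ∀ q → 24 * q ≡ 12 * (q + q)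
    split = solve-∀
  centre : q ∸ 9 + suc e ≡ 2 * suc (k ∸ 5)
  centre = +-cancelˡ-≡ 8 _ _ (begin-equality
    8 + (q ∸ 9 + suc e)      ≡⟨ lhs (q ∸ 9) e ⟩
    9 + (q ∸ 9) + e          ≡⟨ cong (_+ e) (m+[n∸m]≡n (≤-trans (m≤m+n 9 15) 24≤q)) ⟩
    q + e                    ≡⟨ q+e≡2k ⟩
    2 * k                    ≡⟨ cong (2 *_) (m+[n∸m]≡n (≤-trans (m≤m+n 5 19) (≤-trans 24≤q q≤k))) ⟨
    2 * (5 + (k ∸ 5))        ≡⟨ rhs (k ∸ 5) ⟩
    8 + 2 * suc (k ∸ 5)      ∎)
    where
    lhs : ∀ q e → 8 + (q + suc e) ≡ 9 + q + e
    lhs = solve-∀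
    rhs : ∀ k → 2 * (5 + k) ≡ 8 + 2 * suc k
    rhs = solve-∀
  deviation : 8 * suc e ≤ (q ∸ 9) * (q ∸ 9)
  -- Since `q + e = 2 k`, adding `24 q` to `72 (e + 1)` gives `48 (k + e) + 72`, which the
  -- hypothesis bounds by `4 q² + 72`. With `q = 24 + r` this falls short of `9 (q - 9)² + 24 q` by
  -- `5 r² + 102 r + 225`.
  deviation = *-cancelˡ-≤ 9 (+-cancelʳ-≤ (24 * q) _ _ (begin
    9 * (8 * suc e) + 24 * q                   ≡⟨ e₁ e q ⟩
    24 * (q + e) + 48 * e + 72                 ≡⟨ cong (λ x → 24 * x + 48 * e + 72) q+e≡2k ⟩
    24 * (2 * k) + 48 * e + 72                 ≡⟨ e₂ k e ⟩
    4 * (12 * (k + e)) + 72                    ≤⟨ +-monoˡ-≤ 72 (*-monoʳ-≤ 4 12n≤q²) ⟩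
    4 * q ^ 2 + 72                             ≡⟨ cong (λ x → 4 * x ^ 2 + 72) q≡ ⟨
    4 * (24 + r) ^ 2 + 72                      ≤⟨ m≤m+n _ (5 * (r * r) + 102 * r + 225) ⟩
    4 * (24 + r) ^ 2 + 72 + (5 * (r * r) + 102 * r + 225) ≡⟨ e₃ r ⟩
    9 * ((15 + r) * (15 + r)) + 24 * (24 + r)  ≡⟨ cong₂ (λ x y → 9 * (x * x) + 24 * y) q∸9≡ q≡ ⟩
    9 * ((q ∸ 9) * (q ∸ 9)) + 24 * q           ∎))
    where
    r = q ∸ 24
    q≡ : 24 + r ≡ q
    q≡ = m+[n∸m]≡n 24≤q
    q∸9≡ : 15 + r ≡ q ∸ 9
    q∸9≡ = cong (_∸ 9) q≡
    e₁ : ∀ e q → 9 * (8 * suc e) + 24 * q ≡ 24 * (q + e) + 48 * e + 72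
    e₁ = solve-∀
    e₂ : ∀ k e → 24 * (2 * k) + 48 * e + 72 ≡ 4 * (12 * (k + e)) + 72
    e₂ = solve-∀
    e₃ : ∀ r → 4 * ((24 + r) * ((24 + r) * 1)) + 72 + (5 * (r * r) + 102 * r + 225) ≡ 9 * ((15 + r) * (15 + r)) + 24 * (24 + r)
    e₃ = solve-∀

-- In inner-bound and outer-bound k = 5 + j and e = n - k; in boundary-bound e = n - k - 1.
inner-bound : ∀ {j e} → 5 + j ≤ e → 7 * 2 ^ suc e ≤ 8 * sumBinom (suc e) j →
  12 * (2 ^ (5 + j) + 2 ^ e) < 11 * (sumBinom (4 + j) j + sumBinom (suc e) j)
-- The 7/8 bounds are worth `1232 * 2 ^ j + 154 * 2 ^ e` against the required
-- `3072 * 2 ^ j + 96 * 2 ^ e`. The spare `58 * 2 ^ e` is at least `1856 * 2 ^ j`, more than the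
-- missing `1840 * 2 ^ j`.
inner-bound {j} {e} k≤e tail = *-cancelˡ-< 8 _ _ (begin-strict
  8 * (12 * (2 ^ (5 + j) + 2 ^ e))        ≡⟨ e₁ (2 ^ j) (2 ^ e) ⟩
  1840 * 2 ^ j + (1232 * 2 ^ j + 96 * 2 ^ e) <⟨ +-monoˡ-< (1232 * 2 ^ j + 96 * 2 ^ e) (*-monoˡ-< (2 ^ j) {{m^n≢0 2 j}} {1840} {1856} (m≤m+n 1841 15)) ⟩
  1856 * 2 ^ j + (1232 * 2 ^ j + 96 * 2 ^ e) ≡⟨ cong (_+ (1232 * 2 ^ j + 96 * 2 ^ e)) (e₂ (2 ^ j)) ⟩
  58 * 2 ^ (5 + j) + (1232 * 2 ^ j + 96 * 2 ^ e) ≤⟨ +-monoˡ-≤ (1232 * 2 ^ j + 96 * 2 ^ e) (*-monoʳ-≤ 58 (^-monoʳ-≤ 2 k≤e)) ⟩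
  58 * 2 ^ e + (1232 * 2 ^ j + 96 * 2 ^ e) ≡⟨ e₃ (2 ^ j) (2 ^ e) ⟩
  11 * (7 * 2 ^ (4 + j) + 7 * 2 ^ suc e)  ≤⟨ *-monoʳ-≤ 11 (+-mono-≤ (sumBinom-fraction-anti {7} {8} j 4+j≤1+e tail) tail) ⟩
  11 * (8 * sumBinom (4 + j) j + 8 * sumBinom (suc e) j) ≡⟨ e₄ (sumBinom (4 + j) j) (sumBinom (suc e) j) ⟩
  8 * (11 * (sumBinom (4 + j) j + sumBinom (suc e) j)) ∎)
  where
  open ≤-Reasoning
  4+j≤1+e : 4 + j ≤ suc e
  4+j≤1+e = ≤-trans (n≤1+n _) (m≤n⇒m≤1+n k≤e)
  e₁ : ∀ p x → 8 * (12 * (2 * (2 * (2 * (2 * (2 * p)))) + x)) ≡ 1840 * p + (1232 * p + 96 * x)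
  e₁ = solve-∀
  e₂ : ∀ p → 1856 * p ≡ 58 * (2 * (2 * (2 * (2 * (2 * p)))))
  e₂ = solve-∀
  e₃ : ∀ p x → 58 * x + (1232 * p + 96 * x) ≡ 11 * (7 * (2 * (2 * (2 * (2 * p)))) + 7 * (2 * x))
  e₃ = solve-∀
  e₄ : ∀ u v → 11 * (8 * u + 8 * v) ≡ 8 * (11 * (u + v))
  e₄ = solve-∀

outer-bound : ∀ {j e} → 5 + j ≤ e → 7 * 2 ^ suc e ≤ 8 * sumBinom (suc e) j →
  12 * (2 ^ (5 + j) + 2 ^ e) < sumBinom j (4 + j) + sumBinom (5 + e) (4 + j)
outer-bound {j} {e} k≤e tail = begin-strict
  -- The supersets alone suffice: four more points and four more allowed elements give a factor 16,
  -- and 16 times 7/8 of `2 ^ suc e` is `28 * 2 ^ e`, while the left side is at most `24 * 2 ^ e`.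
  12 * (2 ^ (5 + j) + 2 ^ e)          ≤⟨ *-monoʳ-≤ 12 (+-monoˡ-≤ (2 ^ e) (^-monoʳ-≤ 2 k≤e)) ⟩
  12 * (2 ^ e + 2 ^ e)                ≡⟨ e₁ (2 ^ e) ⟩
  24 * 2 ^ e                          <⟨ *-monoˡ-< (2 ^ e) {{m^n≢0 2 e}} {24} {28} (m≤m+n 25 3) ⟩
  28 * 2 ^ e                          ≡⟨ e₂ (2 ^ e) ⟩
  2 * (7 * 2 ^ suc e)                 ≤⟨ *-monoʳ-≤ 2 tail ⟩
  2 * (8 * sumBinom (suc e) j)        ≡⟨ *-assoc 2 8 (sumBinom (suc e) j) ⟨
  2 ^ 4 * sumBinom (suc e) j          ≤⟨ sumBinom-+-+-≥ 4 (suc e) j ⟩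
  sumBinom (4 + suc e) (4 + j)        ≡⟨ cong (λ x → sumBinom x (4 + j)) (+-suc 4 e) ⟩
  sumBinom (5 + e) (4 + j)            ≤⟨ m≤n+m _ (sumBinom j (4 + j)) ⟩
  sumBinom j (4 + j) + sumBinom (5 + e) (4 + j) ∎
  where
  open ≤-Reasoning
  e₁ : ∀ x → 12 * (x + x) ≡ 24 * x
  e₁ = solve-∀
  e₂ : ∀ x → 28 * x ≡ 2 * (7 * (2 * x))
  e₂ = solve-∀

boundary-bound : ∀ {j e} → 6 + j ≤ e → 7 * 2 ^ suc (suc e) ≤ 8 * sumBinom (suc (suc e)) j →
  2 ^ (6 + j) + 2 ^ e ≤ sumBinom (5 + j) (4 + j) + sumBinom (suc e) (4 + j)
-- The terms in `2 ^ j` are short by `288 * 2 ^ j`, and the spare `6 * 2 ^ e` is at least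
-- `384 * 2 ^ j`; the slack is `96 * 2 ^ j`.
boundary-bound {j} {e} k<e tail = *-cancelˡ-≤ 8 (begin
  8 * (2 ^ (6 + j) + 2 ^ e)           ≤⟨ m≤m+n _ _ ⟩
  8 * (2 ^ (6 + j) + 2 ^ e) + 96 * 2 ^ j ≡⟨ e₁ (2 ^ j) (2 ^ e) ⟩
  7 * 2 ^ (5 + j) + (8 * 2 ^ e + 6 * 2 ^ (6 + j)) ≤⟨ +-monoʳ-≤ (7 * 2 ^ (5 + j)) (+-monoʳ-≤ (8 * 2 ^ e) (*-monoʳ-≤ 6 (^-monoʳ-≤ 2 k<e))) ⟩
  7 * 2 ^ (5 + j) + (8 * 2 ^ e + 6 * 2 ^ e) ≡⟨ cong (λ x → 7 * 2 ^ (5 + j) + x) (e₂ (2 ^ e)) ⟩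
  7 * 2 ^ (5 + j) + 7 * 2 ^ suc e     ≤⟨ +-mono-≤ (shrink (m≤n⇒m≤1+n (m≤n⇒m≤1+n (≤-trans (n≤1+n _) k<e)))) (shrink (n≤1+n _)) ⟩
  8 * sumBinom (5 + j) (4 + j) + 8 * sumBinom (suc e) (4 + j) ≡⟨ *-distribˡ-+ 8 (sumBinom (5 + j) (4 + j)) (sumBinom (suc e) (4 + j)) ⟨
  8 * (sumBinom (5 + j) (4 + j) + sumBinom (suc e) (4 + j)) ∎)
  where
  open ≤-Reasoning
  shrink : ∀ {m} → m ≤ suc (suc e) → 7 * 2 ^ m ≤ 8 * sumBinom m (4 + j)
  shrink {m} m≤ = ≤-trans (sumBinom-fraction-anti {7} {8} j m≤ tail) (*-monoʳ-≤ 8 (sumBinom-monoʳ m (m≤n+m j 4)))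
  e₁ : ∀ p x → 8 * (2 * (2 * (2 * (2 * (2 * (2 * p))))) + x) + 96 * p ≡ 7 * (2 * (2 * (2 * (2 * (2 * p))))) + (8 * x + 6 * (2 * (2 * (2 * (2 * (2 * (2 * p)))))))
  e₁ = solve-∀
  e₂ : ∀ x → 8 * x + 6 * x ≡ 7 * (2 * x)
  e₂ = solve-∀

-- Enumerating the small subsets and the large supersets of a set.

module _ {a} {A : Set a} where

  length-mono-⊆ : ∀ {xs ys : List A} → Unique xs → (∀ {x} → x ∈ xs → x ∈ ys) → length xs ≤ length ys
  length-mono-⊆ {[]}     _           _     = z≤n
  length-mono-⊆ {x ∷ xs} u@(_ ∷ uxs) xs⊆ys with ∈-∃++ (xs⊆ys (here refl))
  ... | us , vs , refl = begin
    suc (length xs)               ≤⟨ s≤s (length-mono-⊆ uxs xs⊆us++vs) ⟩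
    suc (length (us ++ vs))       ≡⟨ cong suc (length-++ us) ⟩
    suc (length us + length vs)   ≡⟨ +-suc (length us) (length vs) ⟨
    length us + length (x ∷ vs)   ≡⟨ length-++ us ⟨
    length (us ++ x ∷ vs)         ∎
    where
    open ≤-Reasoning
    xs⊆us++vs : ∀ {y} → y ∈ xs → y ∈ us ++ vs
    xs⊆us++vs y∈xs with ∈-++⁻ us (xs⊆ys (there y∈xs))
    ... | inj₁ y∈us         = ∈-++⁺ˡ y∈us
    ... | inj₂ (here refl)  = contradiction y∈xs (Unique[x∷xs]⇒x∉xs u)
    ... | inj₂ (there y∈vs) = ∈-++⁺ʳ us y∈vs

-- The recursion follows Pascal's rule, so that `sumBinom-pascal` computes the length.
below : ∀ {n} → ℕ → Subset n → List (Subset n)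
below j       []            = [ [] ]
below j       (outside ∷ B) = map (outside ∷_) (below j B)
below zero    (inside ∷ B)  = map (outside ∷_) (below zero B)
below (suc j) (inside ∷ B)  = map (outside ∷_) (below (suc j) B) ++ map (inside ∷_) (below j B)

length-below : ∀ {n} j (B : Subset n) → length (below j B) ≡ sumBinom ∣ B ∣ j
length-below j       []            = sym (sumBinom-zeroˡ j)
length-below j       (outside ∷ B) = trans (length-map _ (below j B)) (length-below j B)
length-below zero    (inside ∷ B)  = trans (length-map _ (below zero B)) (length-below zero B)
length-below (suc j) (inside ∷ B)  = begin
  length (map (outside ∷_) (below (suc j) B) ++ map (inside ∷_) (below j B))
    ≡⟨ length-++ (map (outside ∷_) (below (suc j) B)) ⟩
  length (map (outside ∷_) (below (suc j) B)) + length (map (inside ∷_) (below j B))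
    ≡⟨ cong₂ _+_ (trans (length-map _ (below (suc j) B)) (length-below (suc j) B))
                 (trans (length-map _ (below j B)) (length-below j B)) ⟩
  (sumBinom ∣ B ∣ (suc j)) + (sumBinom ∣ B ∣ j)
    ≡⟨ sumBinom-pascal ∣ B ∣ j ⟨
  sumBinom (suc ∣ B ∣) (suc j) ∎
  where open ≡-Reasoning

unique-below : ∀ {n} j (B : Subset n) → Unique (below j B)
unique-below j       []            = [] ∷ []
unique-below j       (outside ∷ B) = Unique.map⁺ Vec.∷-injectiveʳ (unique-below j B)
unique-below zero    (inside ∷ B)  = Unique.map⁺ Vec.∷-injectiveʳ (unique-below zero B)
unique-below (suc j) (inside ∷ B)  =
  Unique.++⁺ (Unique.map⁺ Vec.∷-injectiveʳ (unique-below (suc j) B)) (Unique.map⁺ Vec.∷-injectiveʳ (unique-below j B))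
    λ { (p , q) → case-heads (∈-map⁻ _ p) (∈-map⁻ _ q) }
  where
  case-heads : ∀ {C} → (∃ λ X → X ∈ below (suc j) B × C ≡ outside ∷ X) → (∃ λ X → X ∈ below j B × C ≡ inside ∷ X) → _
  case-heads (_ , _ , refl) (_ , _ , ())

∈-below⁻ : ∀ {n} j (B : Subset n) {C} → C ∈ below j B → C ⊆ B × ∣ C ∣ ≤ j
∈-below⁻ j [] (here refl) = id , z≤n
∈-below⁻ j (outside ∷ B) C∈ with ∈-map⁻ _ C∈
... | _ , X∈ , refl with X⊆B , ∣X∣≤j ← ∈-below⁻ j B X∈ = out⊆ X⊆B , ∣X∣≤j
∈-below⁻ zero (inside ∷ B) C∈ with ∈-map⁻ _ C∈
... | _ , X∈ , refl with X⊆B , ∣X∣≤j ← ∈-below⁻ zero B X∈ = out⊆ X⊆B , ∣X∣≤j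
∈-below⁻ (suc j) (inside ∷ B) C∈ with ∈-++⁻ (map (outside ∷_) (below (suc j) B)) C∈
... | inj₁ C∈ˡ with _ , X∈ , refl ← ∈-map⁻ _ C∈ˡ with X⊆B , ∣X∣≤j ← ∈-below⁻ (suc j) B X∈ = out⊆ X⊆B , ∣X∣≤j
... | inj₂ C∈ʳ with _ , X∈ , refl ← ∈-map⁻ _ C∈ʳ with X⊆B , ∣X∣≤j ← ∈-below⁻ j B X∈ = in⊆in X⊆B , s≤s ∣X∣≤j

∈-below⁺ : ∀ {n} j (B : Subset n) {C} → C ⊆ B → ∣ C ∣ ≤ j → C ∈ below j B
∈-below⁺ j       []            {[]}          _   _  = here refl
∈-below⁺ j       (outside ∷ B) {outside ∷ C} C⊆B ≤j = ∈-map⁺ _ (∈-below⁺ j B (drop-∷-⊆ C⊆B) ≤j)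
∈-below⁺ j       (outside ∷ B) {inside ∷ C}  C⊆B ≤j with () ← C⊆B here
∈-below⁺ zero    (inside ∷ B)  {outside ∷ C} C⊆B ≤j = ∈-map⁺ _ (∈-below⁺ zero B (drop-∷-⊆ C⊆B) ≤j)
∈-below⁺ (suc j) (inside ∷ B)  {outside ∷ C} C⊆B ≤j = ∈-++⁺ˡ (∈-map⁺ _ (∈-below⁺ (suc j) B (drop-∷-⊆ C⊆B) ≤j))
∈-below⁺ (suc j) (inside ∷ B)  {inside ∷ C}  C⊆B (s≤s ≤j) =
  ∈-++⁺ʳ (map (outside ∷_) (below (suc j) B)) (∈-map⁺ _ (∈-below⁺ j B (drop-∷-⊆ C⊆B) ≤j))

∁-involutive : ∀ {n} (B : Subset n) → ∁ (∁ B) ≡ B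
∁-involutive B = ⊆-antisym (λ x∈ → x∉∁p⇒x∈p (x∈∁p⇒x∉p x∈)) (λ x∈ → x∉p⇒x∈∁p (x∈p⇒x∉∁p x∈))

∁-injective : ∀ {n} {B C : Subset n} → ∁ B ≡ ∁ C → B ≡ C
∁-injective {B = B} {C} eq = trans (sym (∁-involutive B)) (trans (cong ∁ eq) (∁-involutive C))

m∸n≤o⇒m∸o≤n : ∀ {m} n o → m ∸ n ≤ o → m ∸ o ≤ n
m∸n≤o⇒m∸o≤n {m} n o le = m≤n+o⇒m∸n≤o m o (≤-trans (m≤n+m∸n m n) (≤-trans (+-monoʳ-≤ n le) (≤-reflexive (+-comm n o))))

-- Complementation reverses inclusion and turns size at most `j` into size at least `n ∸ j`, so the
-- facts about `below` carry over.
above : ∀ {n} → ℕ → Subset n → List (Subset n)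
above j B = map ∁ (below j (∁ B))

length-above : ∀ {n} j (B : Subset n) → length (above j B) ≡ sumBinom (n ∸ ∣ B ∣) j
length-above j B = trans (length-map ∁ (below j (∁ B)))
  (trans (length-below j (∁ B)) (cong (λ x → sumBinom x j) (∣∁p∣≡n∸∣p∣ B)))

unique-above : ∀ {n} j (B : Subset n) → Unique (above j B)
unique-above j B = Unique.map⁺ ∁-injective (unique-below j (∁ B))

∈-above⁻ : ∀ {n} j (B : Subset n) {C} → C ∈ above j B → B ⊆ C × n ∸ j ≤ ∣ C ∣
∈-above⁻ {n} j B C∈ with X , X∈ , refl ← ∈-map⁻ ∁ C∈ with X⊆∁B , ∣X∣≤j ← ∈-below⁻ j (∁ B) X∈ =
  subst (_⊆ ∁ X) (∁-involutive B) (p⊆q⇒∁p⊇∁q X⊆∁B) ,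
  subst (n ∸ j ≤_) (sym (∣∁p∣≡n∸∣p∣ X)) (∸-monoʳ-≤ n ∣X∣≤j)

∈-above⁺ : ∀ {n} j (B : Subset n) {C} → B ⊆ C → n ∸ j ≤ ∣ C ∣ → C ∈ above j B
∈-above⁺ {n} j B {C} B⊆C n∸j≤ = subst (_∈ above j B) (∁-involutive C)
  (∈-map⁺ ∁ (∈-below⁺ j (∁ B) (p⊆q⇒∁p⊇∁q B⊆C) (subst (_≤ j) (sym (∣∁p∣≡n∸∣p∣ C)) (m∸n≤o⇒m∸o≤n j ∣ C ∣ n∸j≤))))

-- A set in both lists would have `n ∸ j ≤ ∣ C ∣ ≤ j`, against `j + j < n`.
unique-below-above : ∀ {n} j (B B′ : Subset n) → j + j < n → Unique (below j B ++ above j B′)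
unique-below-above {n} j B B′ 2j<n = Unique.++⁺ (unique-below j B) (unique-above j B′)
  λ { (C∈ , C∈′) → <⇒≱ 2j<n (subst (_≤ j + j) (m+[n∸m]≡n (m+n≤o⇒m≤o j (<⇒≤ 2j<n)))
        (+-monoʳ-≤ j (≤-trans (proj₂ (∈-above⁻ j B′ C∈′)) (proj₂ (∈-below⁻ j B C∈))))) }

length-below-above : ∀ {n} j (B B′ : Subset n) →
  length (below j B ++ above j B′) ≡ sumBinom ∣ B ∣ j + sumBinom (n ∸ ∣ B′ ∣) j
length-below-above j B B′ = trans (length-++ (below j B)) (cong₂ _+_ (length-below j B) (length-above j B′))

-- This is the family H_j. Its two halves start from different sets, which is why the two preceding
-- lemmas allow `B` and `B′` to differ.
layers : ∀ n → ℕ → List (Subset n)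
layers n j = below j ⊤ ++ above j ⊥

length-layers : ∀ n j → length (layers n j) ≡ M n j
length-layers n j = trans (length-below-above {n} j ⊤ ⊥)
  (cong₂ (λ x y → sumBinom x j + y) (∣⊤∣≡n n) (trans (cong (λ x → sumBinom (n ∸ x) j) (∣⊥∣≡0 n)) (sym (+-identityʳ _))))

∈-layers⁺ : ∀ {n} j {C : Subset n} → InH j C → C ∈ layers n j
∈-layers⁺ j (inj₁ small) = ∈-++⁺ˡ (∈-below⁺ j ⊤ (⊆-max _) small)
∈-layers⁺ {n} j (inj₂ large) = ∈-++⁺ʳ (below {n} j ⊤) (∈-above⁺ j ⊥ (⊆-min _) large)

∈-layers⁻ : ∀ {n} j {C : Subset n} → C ∈ layers n j → InH j C
∈-layers⁻ {n} j C∈ = [ inj₁ ∘ proj₂ ∘ ∈-below⁻ j ⊤ , inj₂ ∘ proj₂ ∘ ∈-above⁻ j ⊥ ]′ (∈-++⁻ (below {n} j ⊤) C∈)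

-- Degrees of comparability and the exchange inequality.

deg : ∀ {n} → List (Subset n) → Subset n → ℕ
deg L A = length (filter (comparable? A) L)

-- Every set of H_j nested with `B` lies in `L`, and by `nested-anti` their number is least when `B`
-- is as close to the middle as H_c permits. Large `B` reduce to small ones by `nested-sym`.
nested≤deg : ∀ {n} j c {B : Subset n} {L} → j + j < n → c + c ≤ n → InH c B → (∀ C → InH j C → C ∈ L) →
  nested n j c ≤ deg L B
nested≤deg {n} j c {B} {L} 2j<n 2c≤n B∈H H⊆L = begin
  nested n j c                          ≤⟨ nested-bound B∈H ⟩
  nested n j ∣ B ∣                      ≡⟨ length-below-above j B B ⟨
  length (below j B ++ above j B)       ≤⟨ length-mono-⊆ (unique-below-above j B B 2j<n) comparable-in-L ⟩
  length (filter (comparable? B) L)     ∎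
  where
  open ≤-Reasoning
  nested-bound : InH c B → nested n j c ≤ nested n j ∣ B ∣
  nested-bound (inj₁ ≤c) = nested-anti j ≤c 2c≤n
  nested-bound (inj₂ n∸c≤) = subst (nested n j c ≤_) (nested-sym j (∣p∣≤n B))
    (nested-anti j (m∸n≤o⇒m∸o≤n c ∣ B ∣ n∸c≤) 2c≤n)
  comparable-in-L : ∀ {C} → C ∈ below j B ++ above j B → C ∈ filter (comparable? B) L
  comparable-in-L C∈ with ∈-++⁻ (below j B) C∈
  ... | inj₁ C∈ˡ with C⊆B , ∣C∣≤j ← ∈-below⁻ j B C∈ˡ = ∈-filter⁺ (comparable? B) (H⊆L _ (inj₁ ∣C∣≤j)) (inj₂ C⊆B)
  ... | inj₂ C∈ʳ with B⊆C , n∸j≤ ← ∈-above⁻ j B C∈ʳ = ∈-filter⁺ (comparable? B) (H⊆L _ (inj₂ n∸j≤)) (inj₁ B⊆C)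

-- With `j = n` the count `nested` becomes `2 ^ a + 2 ^ (n - a)` for a set of size `a`, which is
-- largest at the ends `a = k` and `a = n - k` of the permitted range.
deg≤ : ∀ {n} k {A : Subset n} {L} → Unique L → k ≤ ∣ A ∣ → ∣ A ∣ ≤ n ∸ k → deg L A ≤ 2 ^ k + 2 ^ (n ∸ k)
deg≤ {n} k {A} {L} uL k≤a a≤n∸k = begin
  length (filter (comparable? A) L)     ≤⟨ length-mono-⊆ (Unique.filter⁺ (comparable? A) uL) comparable-to-A ⟩
  length (below n A ++ above n A)       ≡⟨ length-below-above n A A ⟩
  nested n n ∣ A ∣                      ≤⟨ nested-bound (≤-total (∣ A ∣ + ∣ A ∣) n) ⟩
  nested n n k                          ≡⟨ cong₂ _+_ (sumBinom-full k (≤-trans k≤a (∣p∣≤n A))) (sumBinom-full (n ∸ k) (m∸n≤m n k)) ⟩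
  2 ^ k + 2 ^ (n ∸ k)                   ∎
  where
  open ≤-Reasoning
  comparable-to-A : ∀ {C} → C ∈ filter (comparable? A) L → C ∈ below n A ++ above n A
  comparable-to-A {C} C∈ with ∈-filter⁻ (comparable? A) {xs = L} C∈
  ... | _ , inj₁ A⊆C = ∈-++⁺ʳ (below n A) (∈-above⁺ n A A⊆C (≤-trans (≤-reflexive (n∸n≡0 n)) z≤n))
  ... | _ , inj₂ C⊆A = ∈-++⁺ˡ (∈-below⁺ n A C⊆A (∣p∣≤n C))
  nested-bound : ∣ A ∣ + ∣ A ∣ ≤ n ⊎ n ≤ ∣ A ∣ + ∣ A ∣ → nested n n ∣ A ∣ ≤ nested n n k
  nested-bound (inj₁ 2a≤n) = nested-anti n k≤a 2a≤n
  nested-bound (inj₂ n≤2a) = subst (_≤ nested n n k) (nested-sym n (∣p∣≤n A))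
    (nested-anti n k≤n∸a (≤-trans (+-monoʳ-≤ (n ∸ ∣ A ∣) (m≤n+o⇒m∸n≤o n ∣ A ∣ n≤2a)) (≤-reflexive (m∸n+n≡m (∣p∣≤n A)))))
    where
    k≤n∸a : k ≤ n ∸ ∣ A ∣
    k≤n∸a = m+n≤o⇒m≤o∸n k (≤-trans (+-monoʳ-≤ k a≤n∸k) (≤-reflexive (m+[n∸m]≡n (≤-trans k≤a (∣p∣≤n A)))))

-- Comparable pairs are ordered here, and a set common to X and Y is comparable to itself.
pairs : ∀ {n} → List (Subset n) → List (Subset n) → ℕ
pairs X Y = sum (map (deg Y) X)

module _ {n : ℕ} where

  deg-++ : ∀ X Y (A : Subset n) → deg (X ++ Y) A ≡ deg X A + deg Y A
  deg-++ X Y A = trans (cong length (filter-++ (comparable? A) X Y)) (length-++ (filter (comparable? A) X))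

  deg-∷ : ∀ X (A B : Subset n) → deg (B ∷ X) A ≡ deg [ B ] A + deg X A
  deg-∷ X A B = deg-++ [ B ] X A

  deg-singleton-comm : ∀ (A B : Subset n) → deg [ B ] A ≡ deg [ A ] B
  deg-singleton-comm A B with A ⊆? B | B ⊆? A
  ... | yes _ | yes _ = refl
  ... | yes _ | no _  = refl
  ... | no _  | yes _ = refl
  ... | no _  | no _  = refl

  pairs-++ˡ : ∀ X Y (Z : List (Subset n)) → pairs (X ++ Y) Z ≡ pairs X Z + pairs Y Z
  pairs-++ˡ X Y Z = trans (cong sum (map-++ (deg Z) X Y)) (sum-++ (map (deg Z) X) (map (deg Z) Y))

  pairs-∷ʳ : ∀ X (B : Subset n) Y → pairs X (B ∷ Y) ≡ deg X B + pairs X Y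
  pairs-∷ʳ []      B Y = refl
  pairs-∷ʳ (A ∷ X) B Y = begin
    deg (B ∷ Y) A + pairs X (B ∷ Y)
      ≡⟨ cong₂ _+_ (deg-∷ Y A B) (pairs-∷ʳ X B Y) ⟩
    (deg [ B ] A + deg Y A) + (deg X B + pairs X Y)
      ≡⟨ cong (λ x → (x + deg Y A) + (deg X B + pairs X Y)) (deg-singleton-comm A B) ⟩
    (deg [ A ] B + deg Y A) + (deg X B + pairs X Y)
      ≡⟨ interchange (deg [ A ] B) (deg Y A) (deg X B) (pairs X Y) ⟩
    (deg [ A ] B + deg X B) + (deg Y A + pairs X Y)
      ≡⟨ cong (_+ (deg Y A + pairs X Y)) (deg-∷ X B A) ⟨
    deg (A ∷ X) B + (deg Y A + pairs X Y) ∎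
    where
    open ≡-Reasoning
    interchange : ∀ a b c d → (a + b) + (c + d) ≡ (a + c) + (b + d)
    interchange = solve-∀

  pairs-comm : ∀ X (Y : List (Subset n)) → pairs X Y ≡ pairs Y X
  pairs-comm []      []      = refl
  pairs-comm []      (B ∷ Y) = pairs-comm [] Y
  pairs-comm (A ∷ X) Y       = trans (cong (deg Y A +_) (pairs-comm X Y)) (sym (pairs-∷ʳ Y A X))

  pairs-++ʳ : ∀ X Y (Z : List (Subset n)) → pairs X (Y ++ Z) ≡ pairs X Y + pairs X Z
  pairs-++ʳ X Y Z = trans (pairs-comm X (Y ++ Z))
    (trans (pairs-++ˡ Y Z X) (cong₂ _+_ (pairs-comm Y X) (pairs-comm Z X)))

  pairs-++-square : ∀ X (Y : List (Subset n)) →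
    pairs (X ++ Y) (X ++ Y) ≡ pairs X X + (2 * pairs Y X + pairs Y Y)
  pairs-++-square X Y = begin
    pairs (X ++ Y) (X ++ Y)
      ≡⟨ pairs-++ˡ X Y (X ++ Y) ⟩
    pairs X (X ++ Y) + pairs Y (X ++ Y)
      ≡⟨ cong₂ _+_ (pairs-++ʳ X X Y) (pairs-++ʳ Y X Y) ⟩
    (pairs X X + pairs X Y) + (pairs Y X + pairs Y Y)
      ≡⟨ cong (λ x → (pairs X X + x) + (pairs Y X + pairs Y Y)) (pairs-comm X Y) ⟩
    (pairs X X + pairs Y X) + (pairs Y X + pairs Y Y)
      ≡⟨ collect (pairs X X) (pairs Y X) (pairs Y Y) ⟩
    pairs X X + (2 * pairs Y X + pairs Y Y) ∎
    where
    open ≡-Reasoning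
    collect : ∀ a b c → (a + b) + (b + c) ≡ a + (2 * b + c)
    collect = solve-∀

  pairs-↭ : ∀ {X Y : List (Subset n)} → X ↭ Y → pairs X X ≡ pairs Y Y
  pairs-↭ {X} {Y} X↭Y = trans (moveˡ X) (trans (pairs-comm Y X) (moveˡ Y))
    where
    moveˡ : ∀ Z → pairs X Z ≡ pairs Y Z
    moveˡ Z = sum-↭ (↭.map⁺ (deg Z) X↭Y)

  -- Each pair of positions is met in both orders, and each entry is comparable to itself. So among
  -- lists of equal length, maximising `compPairs` means maximising `pairs X X`, which expands
  -- bilinearly.
  2compPairs+length : ∀ (X : List (Subset n)) → 2 * compPairs X + length X ≡ pairs X X
  2compPairs+length []      = refl
  2compPairs+length (A ∷ X) = begin
    2 * (deg X A + compPairs X) + suc (length X)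
      ≡⟨ rearrange (deg X A) (compPairs X) (length X) ⟩
    suc (deg X A) + (deg X A + (2 * compPairs X + length X))
      ≡⟨ cong₂ (λ x y → x + (deg X A + y)) (sym (cong length (filter-accept (comparable? A) (inj₁ (⊆-refl {x = A})))))
               (2compPairs+length X) ⟩
    deg (A ∷ X) A + (deg X A + pairs X X)
      ≡⟨ cong (deg (A ∷ X) A +_) (pairs-∷ʳ X A X) ⟨
    deg (A ∷ X) A + pairs X (A ∷ X) ∎
    where
    open ≡-Reasoning
    rearrange : ∀ a c l → 2 * (a + c) + suc l ≡ suc a + (a + (2 * c + l))
    rearrange = solve-∀

  length*≤pairs : ∀ d X (Y : List (Subset n)) → (∀ {A} → A ∈ X → d ≤ deg Y A) → length X * d ≤ pairs X Y
  length*≤pairs d []      Y d≤ = z≤n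
  length*≤pairs d (A ∷ X) Y d≤ = +-mono-≤ (d≤ (here refl)) (length*≤pairs d X Y (d≤ ∘ there))

  pairs≤length* : ∀ d X (Y : List (Subset n)) → (∀ {A} → A ∈ X → deg Y A ≤ d) → pairs X Y ≤ length X * d
  pairs≤length* d []      Y ≤d = z≤n
  pairs≤length* d (A ∷ X) Y ≤d = +-mono-≤ (≤d (here refl)) (pairs≤length* d X Y (≤d ∘ there))

  unique-↭ : ∀ {X Y : List (Subset n)} → X ↭ Y → Unique X → Unique Y
  unique-↭ X↭Y = ↭ₛ.Unique-resp-↭ (setoid (Subset n)) (↭⇒↭ₛ X↭Y)

  -- Maximality compares `R ++ S` with `R ++ T`, and `pairs R R` cancels. On the right, doubling
  -- `pairs T T` completes the sum to twice the degrees of `T` in all of `F`, each bounded by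
  -- `deg≤`.
  exchange : ∀ {m k F} R S T → IsMaximiser n m F → F ↭ R ++ T → Unique (R ++ S) → length S ≡ length T →
    (∀ {A} → A ∈ T → k ≤ ∣ A ∣ × ∣ A ∣ ≤ n ∸ k) →
    2 * pairs S R + pairs S S ≤ 2 * (length S * (2 ^ k + 2 ^ (n ∸ k)))
  exchange {m} {k} {F} R S T ((uF , ∣F∣≡m) , maximal) F↭R++T uR++S ∣S∣≡∣T∣ T-middle = begin
    2 * pairs S R + pairs S S
      ≤⟨ +-cancelˡ-≤ (pairs R R) _ _ (subst₂ _≤_ (pairs-++-square R S) (pairs-++-square R T) quadratic) ⟩
    2 * pairs T R + pairs T T
      ≤⟨ +-monoʳ-≤ (2 * pairs T R) (m≤n*m (pairs T T) 2) ⟩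
    2 * pairs T R + 2 * pairs T T
      ≡⟨ *-distribˡ-+ 2 (pairs T R) (pairs T T) ⟨
    2 * (pairs T R + pairs T T)
      ≡⟨ cong (2 *_) (pairs-++ʳ T R T) ⟨
    2 * pairs T (R ++ T)
      ≤⟨ *-monoʳ-≤ 2 (pairs≤length* _ T (R ++ T) λ A∈T →
           deg≤ k (unique-↭ F↭R++T uF) (proj₁ (T-middle A∈T)) (proj₂ (T-middle A∈T))) ⟩
    2 * (length T * (2 ^ k + 2 ^ (n ∸ k)))
      ≡⟨ cong (λ x → 2 * (x * (2 ^ k + 2 ^ (n ∸ k)))) ∣S∣≡∣T∣ ⟨
    2 * (length S * (2 ^ k + 2 ^ (n ∸ k))) ∎
    where
    open ≤-Reasoning
    ∣R++S∣≡m : length (R ++ S) ≡ m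
    ∣R++S∣≡m = trans (length-++ R) (trans (cong (length R +_) ∣S∣≡∣T∣)
      (trans (sym (length-++ R)) (trans (sym (↭.↭-length F↭R++T)) ∣F∣≡m)))
    quadratic : pairs (R ++ S) (R ++ S) ≤ pairs (R ++ T) (R ++ T)
    quadratic = begin
      pairs (R ++ S) (R ++ S)                  ≡⟨ 2compPairs+length (R ++ S) ⟨
      2 * compPairs (R ++ S) + length (R ++ S) ≤⟨ +-mono-≤ (*-monoʳ-≤ 2 (maximal _ (uR++S , ∣R++S∣≡m))) (≤-reflexive (trans ∣R++S∣≡m (sym ∣F∣≡m))) ⟩
      2 * compPairs F + length F               ≡⟨ 2compPairs+length F ⟩
      pairs F F                                ≡⟨ pairs-↭ F↭R++T ⟩
      pairs (R ++ T) (R ++ T)                  ∎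

-- A maximiser contains H_(k-1).

filter-∁-↭ : ∀ {a p} {A : Set a} {P : Pred A p} (P? : Decidable P) xs → xs ↭ filter P? xs ++ filter (∁? P?) xs
filter-∁-↭ {A = A} P? xs = subst (λ (ys , zs) → xs ↭ ys ++ zs) (partition-defn P? xs)
  (↭ₛ⇒↭ (↭ₛ.partition-↭ (setoid A) P? xs))

inH? : ∀ {n} j (A : Subset n) → Dec (InH j A)
inH? {n} j A = (∣ A ∣ ≤? j) ⊎-dec (n ∸ j ≤? ∣ A ∣)

InH-mono : ∀ {n i j} {A : Subset n} → i ≤ j → InH i A → InH j A
InH-mono     i≤j (inj₁ small) = inj₁ (≤-trans small i≤j)
InH-mono {n} i≤j (inj₂ large) = inj₂ (≤-trans (∸-monoʳ-≤ n i≤j) large)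

module _ {n : ℕ} where
  open DecMembership (Vec.≡-dec {n = n} Bool._≟_) public using (_∈?_)

middle : ∀ {n} i {A : Subset n} → ¬ InH i A → suc i ≤ ∣ A ∣ × ∣ A ∣ ≤ n ∸ suc i
middle {n} i {A} A∉H = ≰⇒> (A∉H ∘ inj₁) ,
  subst (∣ A ∣ ≤_) (pred[m∸n]≡m∸[1+n] n i) (pred-mono-≤ (≰⇒> (A∉H ∘ inj₂)))

length≤0⇒∉ : ∀ {a} {A : Set a} {xs : List A} → length xs ≤ 0 → ∀ x → x ∉ xs
length≤0⇒∉ {xs = []} _ x ()

-- O collects the missing sets that lie in the layers InH j and I the other missing ones.  Of every
-- comparable pair between I and O a share 1/12 is charged to the set in I, and 11/12 to the set in O.
layers⊆maximiser : ∀ {n m F} i j → j ≤ i → i + i < n →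
  12 * (2 ^ suc i + 2 ^ (n ∸ suc i)) < 11 * nested n j i →
  12 * (2 ^ suc i + 2 ^ (n ∸ suc i)) < nested n i j →
  IsMaximiser n m F → M n i ≤ m → ∀ A → InH i A → A ∈ F
layers⊆maximiser {n} {m} {F} i j j≤i 2i<n 12D< 12D<′ maxF@((uF , ∣F∣≡m) , _) M≤m =
  λ A A∈H → [ id , (λ A∈S → contradiction A∈S (length≤0⇒∉ s≤0 A)) ]′ (F-or-S A A∈H)
  where
  Missing O I S R₀ T₀ R T : List (Subset n)
  Missing = filter (∁? (_∈? F)) (layers n i)
  O = filter (inH? j) Missing
  I = filter (∁? (inH? j)) Missing
  S = I ++ O
  s = length S
  -- `R₀` and `T₀` are the parts of `F` inside and outside H_i. Any `s` sets of `T₀` may be given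
  -- up; the first `s` are chosen, and `R` is what remains of `F`.
  R₀ = filter (inH? i) F
  T₀ = filter (∁? (inH? i)) F
  R = R₀ ++ drop s T₀
  T = take s T₀

  D : ℕ
  D = 2 ^ suc i + 2 ^ (n ∸ suc i)

  2j<n : j + j < n
  2j<n = ≤-trans (s≤s (+-mono-≤ j≤i j≤i)) 2i<n

  unique-Missing : Unique Missing
  unique-Missing = Unique.filter⁺ (∁? (_∈? F)) (unique-below-above i ⊤ ⊥ 2i<n)

  unique-S : Unique S
  unique-S = Unique.++⁺ (Unique.filter⁺ (∁? (inH? j)) unique-Missing) (Unique.filter⁺ (inH? j) unique-Missing)
    λ { (A∈I , A∈O) → proj₂ (∈-filter⁻ (∁? (inH? j)) {xs = Missing} A∈I) (proj₂ (∈-filter⁻ (inH? j) {xs = Missing} A∈O)) }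

  ∈-Missing : ∀ {A} → A ∈ Missing → InH i A × A ∉ F
  ∈-Missing A∈ with A∈H , A∉F ← ∈-filter⁻ (∁? (_∈? F)) {xs = layers n i} A∈ = ∈-layers⁻ i A∈H , A∉F

  S⊆Missing : ∀ {A} → A ∈ S → A ∈ Missing
  S⊆Missing A∈S = [ proj₁ ∘ ∈-filter⁻ (∁? (inH? j)) , proj₁ ∘ ∈-filter⁻ (inH? j) ]′ (∈-++⁻ I A∈S)

  F-or-S : ∀ A → InH i A → A ∈ F ⊎ A ∈ S
  F-or-S A A∈H with A ∈? F | inH? j A
  ... | yes A∈F | _        = inj₁ A∈F
  ... | no A∉F  | yes A∈Hj = inj₂ (∈-++⁺ʳ I (∈-filter⁺ (inH? j) (∈-filter⁺ (∁? (_∈? F)) (∈-layers⁺ i A∈H) A∉F) A∈Hj))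
  ... | no A∉F  | no A∉Hj  = inj₂ (∈-++⁺ˡ (∈-filter⁺ (∁? (inH? j)) (∈-filter⁺ (∁? (_∈? F)) (∈-layers⁺ i A∈H) A∉F) A∉Hj))

  R-or-S : ∀ A → InH i A → A ∈ R ++ S
  R-or-S A A∈H = [ (λ A∈F → ∈-++⁺ˡ (∈-++⁺ˡ (∈-filter⁺ (inH? i) A∈F A∈H))) , ∈-++⁺ʳ R ]′ (F-or-S A A∈H)

  R-or-O : ∀ A → InH j A → A ∈ R ++ O
  R-or-O A A∈Hj with ∈-++⁻ R (R-or-S A (InH-mono {A = A} j≤i A∈Hj))
  ... | inj₁ A∈R = ∈-++⁺ˡ A∈R
  ... | inj₂ A∈S = ∈-++⁺ʳ R (∈-filter⁺ (inH? j) (S⊆Missing A∈S) A∈Hj)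

  unique-R₀++S : Unique (R₀ ++ S)
  unique-R₀++S = Unique.++⁺ (Unique.filter⁺ (inH? i) uF) unique-S
    λ { (A∈R₀ , A∈S) → proj₂ (∈-Missing (S⊆Missing A∈S)) (proj₁ (∈-filter⁻ (inH? i) A∈R₀)) }

  F↭R₀++T₀ : F ↭ R₀ ++ T₀
  F↭R₀++T₀ = filter-∁-↭ (inH? i) F

  F↭R++T : F ↭ R ++ T
  F↭R++T = ↭-trans F↭R₀++T₀ (↭-trans
    (↭.++⁺ˡ R₀ (↭-trans (↭-reflexive (sym (take++drop≡id s T₀))) (↭.++-comm T (drop s T₀))))
    (↭-sym (↭.++-assoc R₀ (drop s T₀) T)))

  -- `R₀` and `S` are disjoint inside H_i, which has at most `m` sets, while `R₀` and `T₀` together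
  -- have exactly `m`.
  s≤∣T₀∣ : s ≤ length T₀
  s≤∣T₀∣ = +-cancelˡ-≤ (length R₀) _ _ (begin
    length R₀ + s           ≡⟨ length-++ R₀ ⟨
    length (R₀ ++ S)        ≤⟨ length-mono-⊆ unique-R₀++S inLayers ⟩
    length (layers n i) ≡⟨ length-layers n i ⟩
    M n i             ≤⟨ M≤m ⟩
    m                       ≡⟨ ∣F∣≡m ⟨
    length F                ≡⟨ ↭.↭-length F↭R₀++T₀ ⟩
    length (R₀ ++ T₀)       ≡⟨ length-++ R₀ ⟩
    length R₀ + length T₀   ∎)
    where
    open ≤-Reasoning
    inLayers : ∀ {A} → A ∈ R₀ ++ S → A ∈ layers n i
    inLayers A∈ = ∈-layers⁺ i ([ proj₂ ∘ ∈-filter⁻ (inH? i) {xs = F} , proj₁ ∘ ∈-Missing ∘ S⊆Missing ]′ (∈-++⁻ R₀ A∈))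

  ∣S∣≡∣T∣ : s ≡ length T
  ∣S∣≡∣T∣ = sym (trans (length-take s T₀) (m≤n⇒m⊓n≡m s≤∣T₀∣))

  take⊆ : ∀ l {A : Subset n} X → A ∈ take l X → A ∈ X
  take⊆ l X A∈ = subst (_ ∈_) (take++drop≡id l X) (∈-++⁺ˡ A∈)

  drop⊆ : ∀ l {A : Subset n} X → A ∈ drop l X → A ∈ X
  drop⊆ l X A∈ = subst (_ ∈_) (take++drop≡id l X) (∈-++⁺ʳ (take l X) A∈)

  ∈-T₀ : ∀ {A} → A ∈ T₀ → A ∈ F × ¬ InH i A
  ∈-T₀ = ∈-filter⁻ (∁? (inH? i))

  unique-R++S : Unique (R ++ S)
  unique-R++S = Unique.++⁺
    (Unique.++⁺ (Unique.filter⁺ (inH? i) uF) (Unique.drop⁺ s (Unique.filter⁺ (∁? (inH? i)) uF))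
      λ { (A∈R₀ , A∈T₀) → proj₂ (∈-T₀ (drop⊆ s T₀ A∈T₀)) (proj₂ (∈-filter⁻ (inH? i) {xs = F} A∈R₀)) })
    unique-S
    λ { (A∈R , A∈S) → proj₂ (∈-Missing (S⊆Missing A∈S)) (R⊆F A∈R) }
    where
    R⊆F : ∀ {A} → A ∈ R → A ∈ F
    R⊆F A∈R = [ proj₁ ∘ ∈-filter⁻ (inH? i) , proj₁ ∘ ∈-T₀ ∘ drop⊆ s T₀ ]′ (∈-++⁻ R₀ A∈R)

  upper : 2 * pairs S R + pairs S S ≤ 2 * (s * D)
  upper = exchange {k = suc i} R S T maxF F↭R++T unique-R++S ∣S∣≡∣T∣ λ {A} A∈T → middle i {A} (proj₂ (∈-T₀ (take⊆ s T₀ A∈T)))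

  -- Only neighbours in H_j are counted, and these lie in `R ++ O`; no pair inside `I` is used.
  lower-I : length I * suc (12 * D) ≤ 11 * pairs I (R ++ O)
  lower-I = begin
    length I * suc (12 * D)                 ≤⟨ *-monoʳ-≤ (length I) 12D< ⟩
    length I * (11 * nested n j i)    ≡⟨ swap (length I) (nested n j i) ⟩
    11 * (length I * nested n j i)    ≤⟨ *-monoʳ-≤ 11 (length*≤pairs _ I (R ++ O) λ A∈I →
      nested≤deg j i 2j<n (<⇒≤ 2i<n) (proj₁ (∈-Missing (S⊆Missing (∈-++⁺ˡ A∈I)))) R-or-O) ⟩
    11 * pairs I (R ++ O)                   ∎
    where
    open ≤-Reasoning
    swap : ∀ x y → x * (11 * y) ≡ 11 * (x * y)
    swap = solve-∀

  lower-O : length O * suc (12 * D) ≤ pairs O (R ++ S)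
  lower-O = ≤-trans (*-monoʳ-≤ (length O) 12D<′) (length*≤pairs _ O (R ++ S) λ A∈O →
    nested≤deg i j 2i<n (<⇒≤ 2j<n) (proj₂ (∈-filter⁻ (inH? j) {xs = Missing} A∈O)) R-or-S)

  s≤0 : s ≤ 0
  s≤0 = +-cancelʳ-≤ (12 * (s * D)) s 0 (begin
    s + 12 * (s * D)                                   ≡⟨ e₁ s D ⟩
    s * suc (12 * D)                                   ≡⟨ cong (_* suc (12 * D)) (length-++ I) ⟩
    (length I + length O) * suc (12 * D)               ≡⟨ *-distribʳ-+ (suc (12 * D)) (length I) (length O) ⟩
    length I * suc (12 * D) + length O * suc (12 * D)  ≤⟨ +-mono-≤ lower-I lower-O ⟩
    -- A pair between `I` and `O` is counted 11 times from its end in `I` and once from its end in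
    -- `O`: 12 in all, exactly the coefficient of `pairs O I` in six times the left side of `upper`.
    -- The remaining pairs are padded up to that expression.
    11 * pairs I (R ++ O) + pairs O (R ++ S)
      ≡⟨ cong₂ (λ x y → 11 * x + y) (pairs-++ʳ I R O)
           (trans (pairs-++ʳ O R S) (cong (pairs O R +_) (pairs-++ʳ O I O))) ⟩
    11 * (pairs I R + pairs I O) + (pairs O R + (pairs O I + pairs O O))
      ≡⟨ cong (λ x → 11 * (pairs I R + x) + (pairs O R + (pairs O I + pairs O O))) (pairs-comm I O) ⟩
    11 * (pairs I R + pairs O I) + (pairs O R + (pairs O I + pairs O O))
      ≤⟨ m≤m+n _ (pairs I R + 11 * pairs O R + 5 * pairs O O + 6 * pairs I I) ⟩
    11 * (pairs I R + pairs O I) + (pairs O R + (pairs O I + pairs O O)) + (pairs I R + 11 * pairs O R + 5 * pairs O O + 6 * pairs I I)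
      ≡⟨ e₂ (pairs I R) (pairs O I) (pairs O R) (pairs O O) (pairs I I) ⟩
    6 * (2 * (pairs I R + pairs O R) + (pairs I I + (2 * pairs O I + pairs O O)))
      ≡⟨ cong₂ (λ x y → 6 * (2 * x + y)) (pairs-++ˡ I O R) (pairs-++-square I O) ⟨
    6 * (2 * pairs S R + pairs S S)                    ≤⟨ *-monoʳ-≤ 6 upper ⟩
    6 * (2 * (s * D))                                  ≡⟨ *-assoc 6 2 (s * D) ⟨
    12 * (s * D)                                       ∎)
    where
    open ≤-Reasoning
    e₁ : ∀ s d → s + 12 * (s * d) ≡ s * suc (12 * d)
    e₁ = solve-∀
    e₂ : ∀ ir oi or oo ii → 11 * (ir + oi) + (or + (oi + oo)) + (ir + 11 * or + 5 * oo + 6 * ii)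
       ≡ 6 * (2 * (ir + or) + (ii + (2 * oi + oo)))
    e₂ = solve-∀

-- If `A` in `F` lay outside H_k, every `B` in H_k would have to be in `F`: otherwise exchanging `A`
-- for `B` would gain, since the neighbours of `B` in H_i already match the largest degree possible
-- for `A`. Then `F` would contain H_k and `A`, more than `m` sets. The degree comparison is guarded
-- by `suc k + suc k ≤ n`, which the existence of `A` implies.
maximiser⊆layers : ∀ {n m F} i k → i ≤ k →
  (suc k + suc k ≤ n → 2 ^ suc k + 2 ^ (n ∸ suc k) ≤ nested n i k) →
  IsMaximiser n m F → (∀ A → InH i A → A ∈ F) → m ≤ M n k → ∀ A → A ∈ F → InH k A
maximiser⊆layers {n} {m} {F} i k i≤k D≤ maxF@((uF , ∣F∣≡m) , _) H⊆F m≤M A A∈F =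
  decidable-stable (inH? k A) λ A∉H →
    <⇒≱ (some-missing A∉H) (length-mono-⊆ (unique-A∷layers A∉H) (A∷layers⊆F A∉H))
  where
  some-missing : ¬ InH k A → length F < length (A ∷ layers n k)
  some-missing A∉H = s≤s (subst₂ _≤_ (sym ∣F∣≡m) (sym (length-layers n k)) m≤M)

  module _ (A∉H : ¬ InH k A) where

    1+k≤∣A∣ : suc k ≤ ∣ A ∣
    1+k≤∣A∣ = proj₁ (middle k {A} A∉H)

    2[1+k]≤n : suc k + suc k ≤ n
    2[1+k]≤n = m≤o∸n⇒m+n≤o (suc k) (≤-trans 1+k≤∣A∣ (∣p∣≤n A)) (≤-trans 1+k≤∣A∣ (proj₂ (middle k {A} A∉H)))

    2k<n : k + k < n
    2k<n = ≤-trans (s≤s (+-monoʳ-≤ k (n≤1+n k))) 2[1+k]≤n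

    2i<n : i + i < n
    2i<n = ≤-trans (s≤s (+-mono-≤ i≤k i≤k)) 2k<n

    unique-A∷layers : Unique (A ∷ layers n k)
    unique-A∷layers = ¬Any⇒All¬ (layers n k) (A∉H ∘ ∈-layers⁻ k) ∷ unique-below-above k ⊤ ⊥ 2k<n

    present : ∀ {B} → InH k B → B ∈ F
    present {B} B∈H = decidable-stable (B ∈? F) swap
      where
      swap : ¬ B ∉ F
      swap B∉F with us , vs , refl ← ∈-∃++ A∈F = <⇒≱ deg-B< (≤-trans (D≤ 2[1+k]≤n)
          (nested≤deg i k 2i<n (<⇒≤ 2k<n) B∈H H⊆R))
        where
        R : List (Subset n)
        R = us ++ vs

        F↭R++A : F ↭ R ++ [ A ]
        F↭R++A = ↭-trans (↭.shift A us vs) (↭.∷↭∷ʳ A R)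

        unique-R++B : Unique (R ++ [ B ])
        unique-R++B with _ ∷ unique-R ← unique-↭ (↭.shift A us vs) uF =
          unique-↭ (↭.∷↭∷ʳ B R) (¬Any⇒All¬ R (B∉F ∘ ↭.∈-resp-↭ (↭-sym F↭R++A) ∘ ∈-++⁺ˡ) ∷ unique-R)

        H⊆R : ∀ C → InH i C → C ∈ R
        H⊆R X X∈H with ∈-++⁻ R (↭.∈-resp-↭ F↭R++A (H⊆F X X∈H))
        ... | inj₁ X∈R         = X∈R
        ... | inj₂ (here refl) = contradiction (InH-mono {A = A} i≤k X∈H) A∉H

        open ≤-Reasoning
        deg-B< : deg R B < 2 ^ suc k + 2 ^ (n ∸ suc k)
        -- Strictness comes from `pairs [ B ] [ B ] = 1`, as `B` is comparable to itself.
        deg-B< = *-cancelˡ-< 2 _ _ (begin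
          suc (2 * deg R B)                          ≡⟨ +-comm 1 (2 * deg R B) ⟩
          2 * deg R B + 1                            ≡⟨ cong₂ (λ x y → 2 * x + y) (sym (+-identityʳ (deg R B))) (2compPairs+length [ B ]) ⟩
          2 * pairs [ B ] R + pairs [ B ] [ B ]      ≤⟨ exchange {k = suc k} R [ B ] [ A ] maxF F↭R++A unique-R++B refl
                                                          (λ { (here refl) → middle k {A} A∉H }) ⟩
          2 * (1 * (2 ^ suc k + 2 ^ (n ∸ suc k)))    ≡⟨ cong (2 *_) (*-identityˡ (2 ^ suc k + 2 ^ (n ∸ suc k))) ⟩
          2 * (2 ^ suc k + 2 ^ (n ∸ suc k))          ∎)

    A∷layers⊆F : ∀ {C} → C ∈ A ∷ layers n k → C ∈ F
    A∷layers⊆F (here refl) = A∈F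
    A∷layers⊆F (there C∈)  = present (∈-layers⁻ k C∈)

-- Assembling the bounds with k = 5 + j and n = k + e.

maximiser-between-layers : ∀ {n m F} j e → n ≡ 5 + j + e → 5 + j ≤ e →
  7 * 2 ^ suc e ≤ 8 * sumBinom (suc e) j → M n (4 + j) ≤ m → m ≤ M n (5 + j) → IsMaximiser n m F →
  (∀ A → InH (4 + j) A → A ∈ F) × (∀ A → A ∈ F → InH (5 + j) A)
maximiser-between-layers {n} {m} {F} j e n≡k+e k≤e tail M≤m m≤M maxF =
  H⊆F , maximiser⊆layers (4 + j) (5 + j) (n≤1+n (4 + j)) (boundary e n≡k+e tail) maxF H⊆F m≤M
  where
  n∸ : ∀ i f → 5 + j + e ≡ i + f → n ∸ i ≡ f
  n∸ i f k+e≡i+f = trans (cong (_∸ i) (trans n≡k+e k+e≡i+f)) (m+n∸m≡n i f)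

  n∸k≡e : n ∸ (5 + j) ≡ e
  n∸k≡e = n∸ (5 + j) e refl

  n∸j≡ : n ∸ j ≡ 5 + e
  n∸j≡ = n∸ j (5 + e) (shift j e)
    where
    shift : ∀ j e → 5 + j + e ≡ j + (5 + e)
    shift = solve-∀

  2[k-1]<n : 4 + j + (4 + j) < n
  2[k-1]<n = ≤-trans (+-monoʳ-≤ (5 + j) (≤-trans (n≤1+n (4 + j)) k≤e)) (≤-reflexive (sym n≡k+e))

  H⊆F : ∀ A → InH (4 + j) A → A ∈ F
  H⊆F = layers⊆maximiser (4 + j) j (m≤n+m j 4) 2[k-1]<n
    (subst₂ (λ x y → 12 * (2 ^ (5 + j) + 2 ^ x) < 11 * (sumBinom (4 + j) j + sumBinom y j))
      (sym n∸k≡e) (sym (n∸ (4 + j) (suc e) (sym (+-suc (4 + j) e)))) (inner-bound k≤e tail))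
    (subst₂ (λ x y → 12 * (2 ^ (5 + j) + 2 ^ x) < sumBinom j (4 + j) + sumBinom y (4 + j))
      (sym n∸k≡e) (sym n∸j≡) (outer-bound k≤e tail))
    maxF M≤m

  7+j≤ : ∀ e → n ≡ 5 + j + e → 6 + j + (6 + j) ≤ n → 7 + j ≤ e
  7+j≤ e n≡k+e 2[k+1]≤n = +-cancelˡ-≤ (5 + j) (7 + j) e
    (≤-trans (≤-reflexive (+-suc (5 + j) (6 + j))) (≤-trans 2[k+1]≤n (≤-reflexive n≡k+e)))

  -- From `2 (k + 1) ≤ n` it follows that `e ≥ k + 2`, so `e = n - k` has a predecessor
  -- `e′ = n - k - 1`, the exponent needed for sets just outside H_k.
  boundary : ∀ e → n ≡ 5 + j + e → 7 * 2 ^ suc e ≤ 8 * sumBinom (suc e) j → 6 + j + (6 + j) ≤ n →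
    2 ^ (6 + j) + 2 ^ (n ∸ (6 + j)) ≤ nested n (4 + j) (5 + j)
  boundary zero n≡k+e _ 2[k+1]≤n with () ← 7+j≤ zero n≡k+e 2[k+1]≤n
  boundary (suc e′) n≡k+e tail 2[k+1]≤n = subst₂ (λ x y → 2 ^ (6 + j) + 2 ^ x ≤ sumBinom (5 + j) (4 + j) + sumBinom y (4 + j))
    (sym (trans (cong (_∸ (6 + j)) (trans n≡k+e (+-suc (5 + j) e′))) (m+n∸m≡n (6 + j) e′)))
    (sym (trans (cong (_∸ (5 + j)) n≡k+e) (m+n∸m≡n (5 + j) (suc e′))))
    (boundary-bound (s≤s⁻¹ (7+j≤ (suc e′) n≡k+e 2[k+1]≤n)) tail)

open import Data.Integer using (+_)

-- With `n ≤ 3 * k`, squaring `3 k - n ≥ 3 sqrt (2 n ln 2)` gives the equivalent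
-- `18 n ln 2 ≤ (3 k - n)²`. As `ln 2` is the supremum of the sums `lnTwoPartial N`, this amounts to
-- the inequality for every `N`.
theorem1p7 : (n k m : ℕ) → 0 < n
    → n ≤ 3 * k
    → (∀ N → (_/_ (+ (18 * n)) 1) *ᵘ lnTwoPartial N ≤ᵘ (_/_ (+ ((3 * k ∸ n) ^ 2)) 1))
    → 2 * k ≤ n
    → M n (k ∸ 1) ≤ m → m ≤ M n k
    → (F : List (Subset n)) → IsMaximiser n m F
    → (∀ A → InH (k ∸ 1) A → A ∈ F) × (∀ A → A ∈ F → InH k A)
theorem1p7 n k m 0<n n≤3k 18nln2≤q² 2k≤n M≤m m≤M F maxF
  -- The indices `k ∸ 1` and `k` must take the forms `4 + j` and `5 + j` with `j = k ∸ 5`, so the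
  -- whole implication is transported along `5 + (k ∸ 5) ≡ k`, valid because `24 ≤ k`.
  = subst Claim (m+[n∸m]≡n (≤-trans (m≤m+n 5 19) (proj₁ k-large)))
      (λ n≡k+e k≤e M≤m m≤M → maximiser-between-layers (k ∸ 5) (n ∸ k) n≡k+e k≤e (proj₂ k-large) M≤m m≤M maxF)
      (sym k+e≡n) k≤e M≤m m≤M
  where
  Claim : ℕ → Set
  Claim k′ = n ≡ k′ + (n ∸ k) → k′ ≤ n ∸ k → M n (k′ ∸ 1) ≤ m → m ≤ M n k′ →
    (∀ A → InH (k′ ∸ 1) A → A ∈ F) × (∀ A → A ∈ F → InH k′ A)

  k≤n : k ≤ n
  k≤n = ≤-trans (m≤m+n k (k + 0)) 2k≤n

  k+e≡n : k + (n ∸ k) ≡ n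
  k+e≡n = m+[n∸m]≡n k≤n

  k≤e : k ≤ n ∸ k
  k≤e = m+n≤o⇒m≤o∸n k (≤-trans (≤-reflexive (cong (λ x → k + x) (sym (+-identityʳ k)))) 2k≤n)

  0<k : 0 < k
  0<k = *-cancelˡ-< 3 0 k (≤-trans 0<n n≤3k)

  q+e≡2k : 3 * k ∸ n + (n ∸ k) ≡ 2 * k
  q+e≡2k = +-cancelˡ-≡ k _ _ (begin
    k + (3 * k ∸ n + (n ∸ k))   ≡⟨ swap k (3 * k ∸ n) (n ∸ k) ⟩
    3 * k ∸ n + (k + (n ∸ k))   ≡⟨ cong (λ x → 3 * k ∸ n + x) k+e≡n ⟩
    3 * k ∸ n + n               ≡⟨ m∸n+n≡m n≤3k ⟩
    3 * k                       ∎)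
    where
    open ≡-Reasoning
    swap : ∀ a b c → a + (b + c) ≡ b + (a + c)
    swap = solve-∀

  12n≤q² : 12 * (k + (n ∸ k)) ≤ (3 * k ∸ n) ^ 2
  12n≤q² = subst (λ x → 12 * x ≤ (3 * k ∸ n) ^ 2) (sym k+e≡n) (twelve-n≤ n _ (18nln2≤q² 3))

  k-large : 24 ≤ k × 7 * 2 ^ suc (n ∸ k) ≤ 8 * sumBinom (suc (n ∸ k)) (k ∸ 5)
  k-large = small-tail 0<k k≤e q+e≡2k 12n≤q²
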